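{- Degree sequence does not characterize geodesic Leech graphs; that is, there exist two graphs $G$ and $H$ with the same degree sequence such that $G$ is a geodesic Leech graph and $H$ is not a geodesic Leech graph.
   Context: All graphs are finite, simple and undirected. A geodesic path in a graph $G$ is a path with at least one edge which is a shortest path in $G$ between its two end vertices; paths are undirected (a path and its reversal are the same path). The geodesic path number $t_{gp}(G)$ is the total number of geodesic paths in $G$. For an edge labeling $f : E(G) \to \{1,2,3,\dots\}$, the weight of a path $P$ is $w(P) = \sum_{e \in E(P)} f(e)$. The labeling $f$ is a geodesic Leech labeling of $G$ if the set of weights of the $t_{gp}(G)$ geodesic paths in $G$ is $\{1,2,\dots,t_{gp}(G)\}$ (so each of these values is the weight of exactly one geodesic path). A graph which admits a geodesic Leech labeling is called a geodesic Leech graph. -}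

module Defs where

open import Data.Bool.Base using (Bool; false; T)
open import Data.Bool.Properties using (T?)
open import Data.Fin.Base as Fin using (Fin)
open import Data.Fin.Properties as Finₚ using (any?; injective⇒≤)
open import Data.List.Base
  using (List; []; _∷_; head; last; length; lookup; map; filter; allFin; cartesianProductWith)
open import Data.List.Membership.Propositional using (_∈_)
open import Data.List.Membership.Propositional.Properties
  using (∈-allFin; ∈-cartesianProductWith⁺; ∈-cartesianProductWith⁻; ∈-filter⁺; ∈-filter⁻; ∈-lookup)
open import Data.List.Properties using (∷-injective)
import Data.List.Relation.Unary.All as All
open import Data.List.Relation.Unary.AllPairs using ([]; _∷_)
open import Data.List.Relation.Unary.Any using (here; there)
open import Data.List.Relation.Unary.Linked using (Linked; []; [-]; _∷_; linked?)
open import Data.List.Relation.Unary.Unique.Propositional using (Unique)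
import Data.List.Relation.Unary.Unique.Propositional.Properties as Uniqueₚ
import Data.List.Relation.Unary.Unique.DecPropositional as DecUnique
open import Data.List.Sort using (sort)
open import Data.Maybe.Base using (just)
import Data.Maybe.Properties as Maybeₚ
open import Data.Nat.Base using (ℕ; zero; suc; pred; _+_; _≤_; s≤s)
import Data.Nat.Properties as ℕₚ
open import Data.Product.Base using (∃; ∃₂; _×_; _,_; proj₁; proj₂)
open import Function.Base using (_∘_)
open import Function.Bundles using (_⇔_; mk⇔)
open import Relation.Binary.Construct.Flip.EqAndOrd using () renaming (decTotalOrder to flipOrder)
open import Relation.Binary.PropositionalEquality.Core using (_≡_; refl; sym; cong)
open import Relation.Nullary.Decidable using (Dec; map′; _×-dec_; _→-dec_)
open import Relation.Nullary.Negation using (contradiction)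

record Graph (n : ℕ) : Set where
  field
    adj       : Fin n → Fin n → Bool
    symmetric : ∀ u v → adj u v ≡ adj v u
    loopless  : ∀ v → adj v v ≡ false

  Adj : Fin n → Fin n → Set
  Adj u v = T (adj u v)

  Adj? : ∀ u v → Dec (Adj u v)
  Adj? u v = T? (adj u v)

open Graph public using (Adj; Adj?)

degree : ∀ {n} → Graph n → Fin n → ℕ
degree {n} G v = length (filter (Adj? G v) (allFin n))

-- Listed in non-increasing order, hence the flipped order.
degreeSequence : ∀ {n} → Graph n → List ℕ
degreeSequence {n} G = sort (flipOrder ℕₚ.≤-decTotalOrder) (map (degree G) (allFin n))

edgeCount : ∀ {n} → List (Fin n) → ℕ
edgeCount = pred ∘ length

record IsPath {n} (G : Graph n) (u v : Fin n) (vs : List (Fin n)) : Set where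
  constructor mkPath
  field
    starts : head vs ≡ just u
    ends   : last vs ≡ just v
    linked : Linked (Adj G) vs
    unique : Unique vs

record IsGeodesic {n} (G : Graph n) (u v : Fin n) (vs : List (Fin n)) : Set where
  constructor mkGeodesic
  field
    isPath     : IsPath G u v vs
    nontrivial : 1 ≤ edgeCount vs
    shortest   : ∀ ws → IsPath G u v ws → edgeCount vs ≤ edgeCount ws

  open IsPath isPath public

-- A path and its reversal are the same path.  The end vertices of a path with
-- at least one edge are distinct, so each such path has exactly one vertex
-- sequence that begins at the smaller end; that sequence represents the path.
IsGeodesicPath : ∀ {n} → Graph n → List (Fin n) → Set
IsGeodesicPath G vs = ∃₂ λ u v → u Fin.< v × IsGeodesic G u v vs

sequences : ∀ n → ℕ → List (List (Fin n))
sequences n zero    = [] ∷ []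
sequences n (suc k) = [] ∷ cartesianProductWith _∷_ (allFin n) (sequences n k)

∈-sequences : ∀ {n} k (vs : List (Fin n)) → length vs ≤ k → vs ∈ sequences n k
∈-sequences zero    []       _       = here refl
∈-sequences (suc k) []       _       = here refl
∈-sequences (suc k) (v ∷ vs) (s≤s l) =
  there (∈-cartesianProductWith⁺ _∷_ (∈-allFin v) (∈-sequences k vs l))

sequences-unique : ∀ n k → Unique (sequences n k)
sequences-unique n zero    = All.[] ∷ []
sequences-unique n (suc k) = All.tabulate []∉ ∷
  Uniqueₚ.cartesianProductWith⁺ _∷_ ∷-injective (Uniqueₚ.allFin⁺ n) (sequences-unique n k)
  where
  []∉ : ∀ {ws} → ws ∈ cartesianProductWith _∷_ (allFin n) (sequences n k) → [] ≡ ws → _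
  []∉ ws∈ refl with _ , _ , _ , _ , () ← ∈-cartesianProductWith⁻ _∷_ (allFin n) (sequences n k) ws∈

lookup-injective : ∀ {A : Set} {xs : List A} → Unique xs → ∀ i j →
                   lookup xs i ≡ lookup xs j → i ≡ j
lookup-injective (_  ∷ _) Fin.zero    Fin.zero    _  = refl
lookup-injective (p  ∷ _) Fin.zero    (Fin.suc j) eq = contradiction eq (All.lookup p (∈-lookup j))
lookup-injective (p  ∷ _) (Fin.suc i) Fin.zero    eq =
  contradiction (sym eq) (All.lookup p (∈-lookup i))
lookup-injective (_  ∷ q) (Fin.suc i) (Fin.suc j) eq = cong Fin.suc (lookup-injective q i j eq)

unique⇒length≤ : ∀ {n} {vs : List (Fin n)} → Unique vs → length vs ≤ n
unique⇒length≤ q = injective⇒≤ λ {i} {j} → lookup-injective q i j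

isPath? : ∀ {n} (G : Graph n) u v vs → Dec (IsPath G u v vs)
isPath? G u v vs =
  map′ (λ (s , e , l , q) → mkPath s e l q)
       (λ (mkPath s e l q) → s , e , l , q)
       (Maybeₚ.≡-dec Finₚ._≟_ (head vs) (just u)
         ×-dec Maybeₚ.≡-dec Finₚ._≟_ (last vs) (just v)
         ×-dec linked? (Adj? G) vs
         ×-dec DecUnique.unique? Finₚ._≟_ vs)

isGeodesic? : ∀ {n} (G : Graph n) u v vs → Dec (IsGeodesic G u v vs)
isGeodesic? {n} G u v vs =
  map′ (λ (p , t , s) → mkGeodesic p t λ ws q →
          All.lookup s (∈-sequences n ws (unique⇒length≤ (IsPath.unique q))) q)
       (λ (mkGeodesic p t s) → p , t , All.tabulate λ {ws} _ → s ws)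
       (isPath? G u v vs
         ×-dec 1 ℕₚ.≤? edgeCount vs
         ×-dec All.all? (λ ws → isPath? G u v ws →-dec edgeCount vs ℕₚ.≤? edgeCount ws)
                        (sequences n n))

isGeodesicPath? : ∀ {n} (G : Graph n) vs → Dec (IsGeodesicPath G vs)
isGeodesicPath? G vs = any? λ u → any? λ v → u Finₚ.<? v ×-dec isGeodesic? G u v vs

geodesicPaths : ∀ {n} → Graph n → List (List (Fin n))
geodesicPaths {n} G = filter (isGeodesicPath? G) (sequences n n)

-- geodesicPaths lists every geodesic path exactly once.
∈-geodesicPaths : ∀ {n} (G : Graph n) vs → vs ∈ geodesicPaths G ⇔ IsGeodesicPath G vs
∈-geodesicPaths {n} G vs = mk⇔
  (proj₂ ∘ ∈-filter⁻ (isGeodesicPath? G) {xs = sequences n n})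
  (λ p@(_ , _ , _ , g) →
    ∈-filter⁺ (isGeodesicPath? G) (∈-sequences n vs (unique⇒length≤ (IsGeodesic.unique g))) p)

geodesicPaths-unique : ∀ {n} (G : Graph n) → Unique (geodesicPaths G)
geodesicPaths-unique {n} G = Uniqueₚ.filter⁺ (isGeodesicPath? G) (sequences-unique n n)

geodesicPathNumber : ∀ {n} → Graph n → ℕ
geodesicPathNumber G = length (geodesicPaths G)

record EdgeLabeling {n} (G : Graph n) : Set where
  field
    label           : ∀ u v → Adj G u v → ℕ
    label-symmetric : ∀ u v (e : Adj G u v) (e′ : Adj G v u) → label u v e ≡ label v u e′
    label-positive  : ∀ u v (e : Adj G u v) → 1 ≤ label u v e

  weight : ∀ {vs} → Linked (Adj G) vs → ℕ
  weight []      = 0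
  weight [-]     = 0
  weight (e ∷ l) = label _ _ e + weight l

  geodesicWeight : ∀ {vs} → IsGeodesicPath G vs → ℕ
  geodesicWeight (_ , _ , _ , g) = weight (IsGeodesic.linked g)

IsGeodesicLeechLabeling : ∀ {n} (G : Graph n) → EdgeLabeling G → Set
IsGeodesicLeechLabeling G f =
  ∀ w → (∃₂ λ vs (p : IsGeodesicPath G vs) → geodesicWeight p ≡ w)
        ⇔ (1 ≤ w × w ≤ geodesicPathNumber G)
  where open EdgeLabeling f

IsGeodesicLeechGraph : ∀ {n} → Graph n → Set
IsGeodesicLeechGraph G = ∃ (IsGeodesicLeechLabeling G)

{-# OPTIONS --safe #-}
-- G is the disjoint union of a triangle and an edge: its geodesic paths are its four edges,
-- which get the labels 1, 2, 3, 4.  H is the path on five vertices, with ten geodesic paths.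
-- The parity of the weight of a path only depends on the classes of its end vertices in a
-- partition of the vertices into two sets, so the number of odd weights is a product
-- a * (5 - a), which is never 5, the number of odd values among 1, ..., 10 (Taylor's argument).
module Submission where

open import Defs
open import Data.Bool.Base using (Bool; true; false; _∨_)
import Data.Bool.Properties as Boolₚ
open import Data.Fin.Base using (Fin; toℕ)
open import Data.Fin.Patterns using (0F; 1F; 2F; 3F; 4F)
open import Data.Fin.Properties as Finₚ using (all?; injective⇒≤)
open import Data.List.Base using (List; []; _∷_; length; lookup; map; filter; foldr; applyUpTo)
open import Data.List.Membership.Propositional using (_∈_)
open import Data.List.Membership.Propositional.Properties
  using (∈-applyUpTo⁻; ∈-lookup; ∈-map⁺; ∈-map⁻)
open import Data.List.Properties using (length-map; map-∘; map-cong)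
import Data.List.Relation.Unary.All as All
open import Data.List.Relation.Binary.Subset.Propositional using (_⊆_)
open import Data.List.Relation.Binary.Subset.Propositional.Properties using (filter⁺′)
open import Data.List.Relation.Unary.Any using (index; here; there)
open import Data.List.Relation.Unary.Any.Properties using (lookup-index)
open import Data.List.Relation.Unary.Linked as Linked using (Linked; linked?)
open import Data.List.Relation.Unary.Unique.Propositional using (Unique)
import Data.List.Relation.Unary.Unique.Propositional.Properties as Uniqueₚ
open import Data.Nat.Base using (ℕ; suc; _+_; _⊓_; _≤_; _<_; z≤n; s≤s; parity)
open import Data.Nat.ListAction using (sum)
open import Data.Nat.Properties
  using (+-comm; _≤?_; <⇒≢; <⇒≱; <ᵇ⇒<; suc-injective; module ≤-Reasoning)
open import Data.Parity.Base as ℙ using (Parity; 0ℙ; 1ℙ)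
import Data.Parity.Properties as Parityₚ
open import Data.Product.Base using (Σ-syntax; ∃-syntax; ∃₂; _×_; _,_; proj₁; proj₂)
open import Data.Product.Properties using (≡-dec)
open import Function.Base using (id; _∘_; _$_)
open import Function.Bundles using (_⇔_; mk⇔; module Equivalence)
open import Function.Properties.Equivalence using () renaming (trans to ⇔-trans)
open import Level using (0ℓ)
open import Relation.Binary.Definitions using (DecidableEquality)
open import Relation.Binary.PropositionalEquality
  using (_≡_; refl; sym; trans; cong; subst; subst₂)
open import Relation.Nullary.Decidable
  using (True; toWitness; yes; no; does; from-yes; _→-dec_; _×-dec_)
open import Relation.Nullary.Negation using (¬_; contradiction)
open import Relation.Unary using (Pred; Decidable)

-- Pigeonhole: sending each position in `xs` to a position in `ys` with the same entry is injective,
-- because `xs` has no repetitions.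
Unique⇒length≤ : ∀ {A : Set} {xs ys : List A} → Unique xs → xs ⊆ ys → length xs ≤ length ys
Unique⇒length≤ {xs = xs} {ys} xs! xs⊆ys = injective⇒≤ λ {i} {j} → position-injective i j
  where
  position : Fin (length xs) → Fin (length ys)
  position i = index (xs⊆ys (∈-lookup i))

  lookup-position : ∀ i → lookup xs i ≡ lookup ys (position i)
  lookup-position i = lookup-index (xs⊆ys (∈-lookup i))

  position-injective : ∀ i j → position i ≡ position j → i ≡ j
  position-injective i j eq = lookup-injective xs! i j
    (trans (lookup-position i) (trans (cong (lookup ys) eq) (sym (lookup-position j))))

filter-map : ∀ {A B : Set} {P : Pred B 0ℓ} (P? : Decidable P) (f : A → B) xs →
             filter P? (map f xs) ≡ map f (filter (P? ∘ f) xs)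
filter-map P? f []       = refl
filter-map P? f (x ∷ xs) with does (P? (f x))
... | false = filter-map P? f xs
... | true  = cong (f x ∷_) (filter-map P? f xs)

module _ {n} {G : Graph n} (f : EdgeLabeling G) where
  open EdgeLabeling f

  -- `weight` needs a proof of linkedness; recovering it by `linked?` gives a function that can be
  -- mapped over a list and evaluated. The default 0 is never taken on `geodesicPaths G`.
  sequenceWeight : List (Fin n) → ℕ
  sequenceWeight vs with linked? (Adj? G) vs
  ... | yes l = weight l
  ... | no  _ = 0

  -- Adjacency is `T` of a Boolean, hence proof-irrelevant, so all proofs of linkedness give the
  -- same weight.
  sequenceWeight≡weight : ∀ {vs} (l : Linked (Adj G) vs) → sequenceWeight vs ≡ weight l
  sequenceWeight≡weight {vs} l with linked? (Adj? G) vs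
  ... | yes l′ = cong weight (Linked.irrelevant Boolₚ.T-irrelevant l′ l)
  ... | no  ¬l = contradiction l ¬l

  weights : List ℕ
  weights = map sequenceWeight (geodesicPaths G)

  -- Trades the existential over geodesic paths for a list that can be evaluated on a concrete
  -- graph.
  ∈-weights : ∀ w → (∃₂ λ vs (p : IsGeodesicPath G vs) → geodesicWeight p ≡ w) ⇔ w ∈ weights
  ∈-weights w = mk⇔
    (λ { (vs , p@(_ , _ , _ , g) , refl) →
      subst (_∈ weights) (sequenceWeight≡weight (IsGeodesic.linked g))
        (∈-map⁺ sequenceWeight (Equivalence.from (∈-geodesicPaths G vs) p)) })
    (λ w∈ → let vs , vs∈ , w≡ = ∈-map⁻ sequenceWeight w∈
                p@(_ , _ , _ , g) = Equivalence.to (∈-geodesicPaths G vs) vs∈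
            in vs , p , sym (trans w≡ (sequenceWeight≡weight (IsGeodesic.linked g))))

range : ℕ → List ℕ
range = applyUpTo suc

range-unique : ∀ n → Unique (range n)
range-unique n = Uniqueₚ.applyUpTo⁺₁ suc n λ i<j _ → <⇒≢ i<j ∘ suc-injective

range⊆weights : ∀ {n} {G : Graph n} {f : EdgeLabeling G} → IsGeodesicLeechLabeling G f →
                range (geodesicPathNumber G) ⊆ weights f
range⊆weights {f = f} leech {w} w∈ with i , i<n , refl ← ∈-applyUpTo⁻ suc w∈ =
  Equivalence.to (∈-weights f w) (Equivalence.from (leech w) (s≤s z≤n , i<n))

count : Parity → List Parity → ℕ
count p = length ∘ filter (Parityₚ._≟ p)

count-parity : ∀ p xs → count p (map parity xs) ≡ length (filter (λ x → parity x Parityₚ.≟ p) xs)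
count-parity p xs =
  trans (cong length (filter-map (Parityₚ._≟ p) parity xs))
        (length-map parity (filter (λ x → parity x Parityₚ.≟ p) xs))

-- Filtering by parity preserves both uniqueness and inclusion, so the pigeonhole bound applies to
-- each parity separately.
count-parity-mono : ∀ p {xs ys} → Unique xs → xs ⊆ ys →
                    count p (map parity xs) ≤ count p (map parity ys)
count-parity-mono p {xs} {ys} xs! xs⊆ys =
  subst₂ _≤_ (sym (count-parity p xs)) (sym (count-parity p ys))
    (Unique⇒length≤ (Uniqueₚ.filter⁺ P? xs!) (filter⁺′ P? P? id xs⊆ys))
  where
  P? : Decidable (λ x → parity x ≡ p)
  P? x = parity x Parityₚ.≟ p

module _ {n} (edges : List (Fin n × Fin n)) where

  _≟ₑ_ : DecidableEquality (Fin n × Fin n)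
  _≟ₑ_ = ≡-dec Finₚ._≟_ Finₚ._≟_

  open import Data.List.Membership.DecPropositional _≟ₑ_ using (_∈?_)

  listed joined : Fin n → Fin n → Bool
  listed u v = does ((u , v) ∈? edges)
  joined u v = listed u v ∨ listed v u

  fromEdges : {True (all? λ v → joined v v Boolₚ.≟ false)} → Graph n
  fromEdges {loopless} = record
    { adj       = joined
    ; symmetric = λ u v → Boolₚ.∨-comm (listed u v) (listed v u)
    ; loopless  = toWitness loopless
    }

-- sort does not reduce, so the vertices are numbered to have the same degrees in both graphs;
-- the degree sequences then sort the same list.
C₃∪K₂ P₅ : Graph 5
C₃∪K₂ = fromEdges ((0F , 1F) ∷ (1F , 2F) ∷ (0F , 2F) ∷ (3F , 4F) ∷ [])
P₅    = fromEdges ((3F , 0F) ∷ (0F , 1F) ∷ (1F , 2F) ∷ (2F , 4F) ∷ [])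

labeling : EdgeLabeling C₃∪K₂
labeling = record
  { label           = λ u v _ → label u v
  ; label-symmetric = λ u v _ _ → cong (_⊓ 4) (+-comm (toℕ u) (toℕ v))
  ; label-positive  = from-yes (all? λ u → all? λ v → Adj? C₃∪K₂ u v →-dec 1 ≤? label u v)
  }
  where
  -- The triangle edges have end sums 1, 2 and 3; the cap turns the sum 7 of the remaining edge into
  -- 4.
  label : Fin 5 → Fin 5 → ℕ
  label u v = (toℕ u + toℕ v) ⊓ 4

-- `weights labeling` evaluates to `1 ∷ 2 ∷ 3 ∷ 4 ∷ []` and the path number to 4, which leaves a
-- finite check.
labeling-leech : IsGeodesicLeechLabeling C₃∪K₂ labeling
labeling-leech w = ⇔-trans (∈-weights labeling w) (mk⇔
  (All.lookup (from-yes (All.all? (λ w → 1 ≤? w ×-dec w ≤? 4) (1 ∷ 2 ∷ 3 ∷ 4 ∷ []))))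
  (λ { (s≤s {n = 0} _ , _) → here refl
     ; (s≤s {n = 1} _ , _) → there (here refl)
     ; (s≤s {n = 2} _ , _) → there (there (here refl))
     ; (s≤s {n = 3} _ , _) → there (there (there (here refl)))
     ; (s≤s {n = suc (suc (suc (suc _)))} _ , s≤s (s≤s (s≤s (s≤s ())))) }))

-- The labels along each geodesic path of P₅, if its edges are labelled a, b, c, d in order.
P₅-labels : ∀ {A : Set} → A → A → A → A → List (List A)
P₅-labels a b c d =
    (b ∷ []) ∷ (b ∷ c ∷ []) ∷ (b ∷ c ∷ d ∷ []) ∷ (a ∷ []) ∷ (b ∷ a ∷ []) ∷ (c ∷ [])
  ∷ (c ∷ d ∷ []) ∷ (c ∷ b ∷ a ∷ []) ∷ (d ∷ []) ∷ (a ∷ b ∷ c ∷ d ∷ []) ∷ []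

-- Evaluation lists each path from its smaller end, so the edges 3-0, 0-1 and 1-2 are also traversed
-- backwards; symmetry of the labels makes both sides agree.
P₅-weights : (f : EdgeLabeling P₅) → let open EdgeLabeling f in
  weights f ≡ map sum (P₅-labels (label 3F 0F _) (label 0F 1F _) (label 1F 2F _) (label 2F 4F _))
P₅-weights f
  rewrite EdgeLabeling.label-symmetric f 0F 3F _ _
        | EdgeLabeling.label-symmetric f 1F 0F _ _
        | EdgeLabeling.label-symmetric f 2F 1F _ _ = refl

sumℙ : List Parity → Parity
sumℙ = foldr ℙ._+_ 0ℙ

parity-sum : ∀ xs → parity (sum xs) ≡ sumℙ (map parity xs)
parity-sum []       = refl
parity-sum (x ∷ xs) = trans (Parityₚ.+-homo-+ x (sum xs)) (cong (parity x ℙ.+_) (parity-sum xs))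

-- Reduces the parities of all path weights to those of the edge labels, leaving finitely many
-- cases.
map-parity-sum : ∀ xss → map parity (map sum xss) ≡ map sumℙ (map (map parity) xss)
map-parity-sum xss = trans (sym (map-∘ xss)) (trans (map-cong parity-sum xss) (map-∘ xss))

range-balanced : ∀ p → count p (map parity (range 10)) ≡ 5
range-balanced 0ℙ = refl
range-balanced 1ℙ = refl

-- The number of odd weights is 0, 4 or 6 out of ten, so some parity occurs at most four times. The
-- witness is that minority parity, and evaluation confirms each case.
P₅-unbalanced : ∀ a b c d → ∃[ p ] count p (map sumℙ (P₅-labels a b c d)) < 5
P₅-unbalanced 0ℙ 0ℙ 0ℙ 0ℙ = 1ℙ , <ᵇ⇒< _ _ _
P₅-unbalanced 0ℙ 0ℙ 0ℙ 1ℙ = 1ℙ , <ᵇ⇒< _ _ _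
P₅-unbalanced 0ℙ 0ℙ 1ℙ 0ℙ = 0ℙ , <ᵇ⇒< _ _ _
P₅-unbalanced 0ℙ 0ℙ 1ℙ 1ℙ = 1ℙ , <ᵇ⇒< _ _ _
P₅-unbalanced 0ℙ 1ℙ 0ℙ 0ℙ = 0ℙ , <ᵇ⇒< _ _ _
P₅-unbalanced 0ℙ 1ℙ 0ℙ 1ℙ = 0ℙ , <ᵇ⇒< _ _ _
P₅-unbalanced 0ℙ 1ℙ 1ℙ 0ℙ = 1ℙ , <ᵇ⇒< _ _ _
P₅-unbalanced 0ℙ 1ℙ 1ℙ 1ℙ = 0ℙ , <ᵇ⇒< _ _ _
P₅-unbalanced 1ℙ 0ℙ 0ℙ 0ℙ = 1ℙ , <ᵇ⇒< _ _ _
P₅-unbalanced 1ℙ 0ℙ 0ℙ 1ℙ = 0ℙ , <ᵇ⇒< _ _ _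
P₅-unbalanced 1ℙ 0ℙ 1ℙ 0ℙ = 0ℙ , <ᵇ⇒< _ _ _
P₅-unbalanced 1ℙ 0ℙ 1ℙ 1ℙ = 0ℙ , <ᵇ⇒< _ _ _
P₅-unbalanced 1ℙ 1ℙ 0ℙ 0ℙ = 1ℙ , <ᵇ⇒< _ _ _
P₅-unbalanced 1ℙ 1ℙ 0ℙ 1ℙ = 0ℙ , <ᵇ⇒< _ _ _
P₅-unbalanced 1ℙ 1ℙ 1ℙ 0ℙ = 0ℙ , <ᵇ⇒< _ _ _
P₅-unbalanced 1ℙ 1ℙ 1ℙ 1ℙ = 0ℙ , <ᵇ⇒< _ _ _

P₅-not-leech : ¬ IsGeodesicLeechGraph P₅
P₅-not-leech (f , leech) = <⇒≱ few $ begin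
  5                                         ≡⟨ range-balanced p ⟨
  count p (map parity (range 10))
    -- `geodesicPathNumber P₅` evaluates to 10, so the Leech property puts all of `range 10` among
    -- the weights.
    ≤⟨ count-parity-mono p (range-unique 10) (range⊆weights leech) ⟩
  count p (map parity (weights f))          ≡⟨ cong (count p ∘ map parity) (P₅-weights f) ⟩
  count p (map parity (map sum pathLabels)) ≡⟨ cong (count p) (map-parity-sum pathLabels) ⟩
  count p (map sumℙ (map (map parity) pathLabels)) ∎
  where
  open EdgeLabeling f
  open ≤-Reasoning

  pathLabels : List (List ℕ)
  pathLabels = P₅-labels (label 3F 0F _) (label 0F 1F _) (label 1F 2F _) (label 2F 4F _)

  minority = P₅-unbalanced (parity (label 3F 0F _)) (parity (label 0F 1F _))
                           (parity (label 1F 2F _)) (parity (label 2F 4F _))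
  p   = proj₁ minority
  few = proj₂ minority

theorem2p9 : ∃[ m ] ∃[ n ] Σ[ G ∈ Graph m ] Σ[ H ∈ Graph n ]
    (degreeSequence G ≡ degreeSequence H × IsGeodesicLeechGraph G × ¬ IsGeodesicLeechGraph H)
theorem2p9 = 5 , 5 , C₃∪K₂ , P₅ , refl , (labeling , labeling-leech) , P₅-not-leech
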